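{- For all $m,n\ge1$, $$F_{m+1}(x,y,q)F_{n+1}(xq^m,yq^m,q)=xq^mF_{m+n+1}(x,y,q)+y^2q^{2m-1}F_{m-1}(x,y,q)F_{n-1}(xq^{m+2},yq^{m+2},q).$$
   Context: $\Pi_n(13/2,123)$ is the set of layered matchings of $[n]$: set partitions whose blocks are consecutive intervals $[1,i_1]/\dots/[i_{k-1}+1,n]$, each of size $1$ or $2$. $\Pi_0(13/2,123)$ consists of the empty partition. For $\pi=B_1/\dots/B_k$ with $\min B_1<\dots<\min B_k$, $rb(\pi)$ is the number of pairs $(b,B_j)$ with $b\in B_i$, $j>i$, $\max B_j>b$. Let $s(\pi)$ and $d(\pi)$ be the numbers of blocks of size $1$ and $2$. Define $F_n(x,y,q)=\sum_{\pi\in\Pi_n(13/2,123)}x^{s(\pi)}y^{d(\pi)}q^{rb(\pi)}$, so $F_0=1$ and $F_1=x$. $F_n(xq^a,yq^a,q)$ denotes the substitution $x\mapsto xq^a$, $y\mapsto yq^a$. -}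

module Defs where

open import Algebra.Bundles using (CommutativeRing)
import Algebra.Properties.Semiring.Exp as Exp
open import Data.List.Base using (List; []; _∷_; _++_; concat; foldr; filter; length; map)
open import Data.List.Extrema.Nat using (min≤⊤; min≤xs; v≤min⁺) renaming (min to minList; max to maxList)
open import Data.List.Membership.Propositional using (_∈_)
open import Data.List.Membership.Propositional.Properties
  using (∈-map⁺; ∈-map⁻; ∈-++⁺ˡ; ∈-++⁺ʳ; ∈-++⁻; ∈-concat⁻′)
open import Data.List.NonEmpty.Base as List⁺ using (List⁺; toList)
open import Data.List.Properties using (∷-injectiveˡ; ∷-injectiveʳ)
open import Data.List.Relation.Binary.Permutation.Propositional using (_↭_; ↭-refl; ↭-sym; prep)
open import Data.List.Relation.Binary.Permutation.Propositional.Properties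
  using (All-resp-↭; ∈-resp-↭; drop-∷; ¬x∷xs↭[])
open import Data.List.Relation.Unary.All as All using (All; []; _∷_)
import Data.List.Relation.Unary.All.Properties as All
open import Data.List.Relation.Unary.AllPairs using (AllPairs; []; _∷_)
open import Data.List.Relation.Unary.Any using (here; there)
open import Data.List.Relation.Unary.Linked using (Linked; [-]; _∷_)
open import Data.List.Relation.Unary.Unique.Propositional using (Unique)
import Data.List.Relation.Unary.Unique.Propositional.Properties as Unique
open import Data.Nat.ListAction using (sum)
open import Data.Nat.Base using (ℕ; zero; suc; _≤_; _<_; s≤s; _+_)
open import Data.Nat.Properties using (_≟_; _<?_; ≤-refl; ≤-trans; ≤-antisym; <⇒≤; n<1+n; n≮n; <-≤-trans)
open import Data.Product.Base using (_×_; _,_)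
open import Data.Sum.Base using (_⊎_; inj₁; inj₂)
open import Data.Empty using (⊥; ⊥-elim)
open import Function.Base using (_∘_)
open import Function.Bundles using (_⇔_; mk⇔)
open import Relation.Binary.PropositionalEquality.Core using (_≡_; refl; trans; cong)

-- interval a k = a, a + 1, …, a + k − 1; thus [n] is interval 1 n.
interval : ℕ → ℕ → List ℕ
interval a zero    = []
interval a (suc k) = a ∷ interval (suc a) k

-- A block is represented by the increasing list of its elements, and a
-- partition B₁/…/B_k by the list of its blocks in order of their minima.
-- IsSetPartition imposes both conditions, so that the representation of a
-- set partition is unique.
Block : Set
Block = List⁺ ℕ

Partition : Set
Partition = List Block

size minB maxB : Block → ℕ
size = List⁺.length
minB (b List⁺.∷ bs) = minList b bs
maxB (b List⁺.∷ bs) = maxList b bs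

-- The permutation says that the blocks are disjoint with union S.
record IsSetPartition (S : List ℕ) (π : Partition) : Set where
  field
    covers     : concat (map toList π) ↭ S
    increasing : All (Linked _<_ ∘ toList) π
    ordered    : AllPairs (λ B C → minB B < minB C) π

IsInterval : Block → Set
IsInterval B = toList B ≡ interval (minB B) (size B)

record IsLayeredMatching (S : List ℕ) (π : Partition) : Set where
  field
    isSetPartition : IsSetPartition S π
    intervals      : All IsInterval π
    sizes          : All (λ B → size B ≡ 1 ⊎ size B ≡ 2) π

  open IsSetPartition isSetPartition public

-- Counts the pairs (b , Bⱼ) with b ∈ Bᵢ, j > i and max Bⱼ > b, the blocks
-- being listed in order of their minima.
rb : Partition → ℕ
rb []      = 0
rb (B ∷ π) = sum (map (λ b → length (filter (λ C → b <? maxB C) π)) (toList B)) + rb π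

s d : Partition → ℕ
s π = length (filter (λ B → size B ≟ 1) π)
d π = length (filter (λ B → size B ≟ 2) π)

-- The layered matchings of interval a n, listed by the size of the first
-- block.  ∈-matchings⇔ and matchings-unique below show that the list
-- contains each of them exactly once.

single pair : ℕ → Block
single a = a List⁺.∷ []
pair a   = a List⁺.∷ suc a ∷ []

matchings : ℕ → ℕ → List Partition
matchings a zero          = [] ∷ []
matchings a (suc zero)    = (single a ∷ []) ∷ []
matchings a (suc (suc n)) = map (single a ∷_) (matchings (suc a) (suc n))
                         ++ map (pair a ∷_) (matchings (suc (suc a)) n)

-- Πₙ(13/2, 123)
Π : ℕ → List Partition
Π n = matchings 1 n

-- The generating function, as a polynomial expression evaluated at
-- elements x, y, q of an arbitrary commutative ring.

module _ {c ℓ} (R : CommutativeRing c ℓ) where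
  private
    module R = CommutativeRing R
    open Exp R.semiring using (_^_)

  F : ℕ → R.Carrier → R.Carrier → R.Carrier → R.Carrier
  F n x y q = foldr R._+_ R.0# (map (λ π → x ^ s π R.* y ^ d π R.* q ^ rb π) (Π n))

private
  open IsLayeredMatching

  interval-≥ : ∀ a n → All (a ≤_) (interval a n)
  interval-≥ a zero    = []
  interval-≥ a (suc n) = ≤-refl ∷ All.map (≤-trans (<⇒≤ (n<1+n a))) (interval-≥ (suc a) n)

  minB-≤ : ∀ {x} B → x ∈ toList B → minB B ≤ x
  minB-≤ (b List⁺.∷ bs) (here refl) = min≤⊤ b bs
  minB-≤ (b List⁺.∷ bs) (there x∈)  = All.lookup (min≤xs b bs) x∈

  ≤-minB : ∀ {a} B → All (a ≤_) (toList B) → a ≤ minB B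
  ≤-minB (b List⁺.∷ bs) (p ∷ ps) = v≤min⁺ p ps

  blocks-≥ : ∀ {S π a} → All (a ≤_) S → concat (map toList π) ↭ S →
             All (λ B → a ≤ minB B) π
  blocks-≥ S≥a p =
    All.map (λ {B} → ≤-minB B) (All.map⁻ (All.concat⁻ (All-resp-↭ (↭-sym p) S≥a)))

  pair-isInterval : ∀ a → IsInterval (pair a)
  pair-isInterval a = cong (λ m → m ∷ suc m ∷ [])
    (≤-antisym (v≤min⁺ ≤-refl (<⇒≤ (n<1+n a) ∷ [])) (min≤⊤ a (suc a ∷ [])))

  cons-single : ∀ {a n π} → IsLayeredMatching (interval (suc a) n) π →
                IsLayeredMatching (interval a (suc n)) (single a ∷ π)
  cons-single {a} {n} L = record
    { isSetPartition = record
      { covers     = prep a (covers L)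
      ; increasing = [-] ∷ increasing L
      ; ordered    = blocks-≥ (interval-≥ (suc a) n) (covers L) ∷ ordered L
      }
    ; intervals = refl ∷ intervals L
    ; sizes     = inj₁ refl ∷ sizes L
    }

  cons-pair : ∀ {a n π} → IsLayeredMatching (interval (suc (suc a)) n) π →
              IsLayeredMatching (interval a (suc (suc n))) (pair a ∷ π)
  cons-pair {a} {n} L = record
    { isSetPartition = record
      { covers     = prep a (prep (suc a) (covers L))
      ; increasing = (n<1+n a ∷ [-]) ∷ increasing L
      ; ordered    = All.map (≤-trans (s≤s (≤-trans (min≤⊤ a (suc a ∷ [])) (<⇒≤ (n<1+n a)))))
                             (blocks-≥ (interval-≥ (suc (suc a)) n) (covers L)) ∷ ordered L
      }
    ; intervals = pair-isInterval a ∷ intervals L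
    ; sizes     = inj₂ refl ∷ sizes L
    }

  empty : ∀ {a} → IsLayeredMatching (interval a 0) []
  empty = record
    { isSetPartition = record { covers = ↭-refl ; increasing = [] ; ordered = [] }
    ; intervals = []
    ; sizes     = []
    }

  sound : ∀ a n {π} → π ∈ matchings a n → IsLayeredMatching (interval a n) π
  sound a zero (here refl) = empty {a}
  sound a (suc zero) (here refl) = cons-single (empty {suc a})
  sound a (suc (suc n)) π∈ with ∈-++⁻ (map (single a ∷_) (matchings (suc a) (suc n))) π∈
  ... | inj₁ p with _ , q , refl ← ∈-map⁻ (single a ∷_) p = cons-single (sound (suc a) (suc n) q)
  ... | inj₂ p with _ , q , refl ← ∈-map⁻ (pair a ∷_) p = cons-pair (sound (suc (suc a)) n q)

  head-≥ : ∀ a n {B π} → IsLayeredMatching (interval a n) (B ∷ π) → a ≤ minB B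
  head-≥ a n {B} {π} L = All.head (blocks-≥ {π = B ∷ π} (interval-≥ a n) (covers L))

  minB-first : ∀ a n {B π} → IsLayeredMatching (interval a (suc n)) (B ∷ π) → minB B ≡ a
  minB-first a n {B} {π} L with ∈-concat⁻′ (map toList (B ∷ π)) (∈-resp-↭ (↭-sym (covers L)) (here refl))
  ... | _ , a∈ , here refl = ≤-antisym (minB-≤ B a∈) (head-≥ a (suc n) L)
  ... | _ , a∈ , there C∈ with C , C∈π , refl ← ∈-map⁻ toList C∈ | B<π ∷ _ ← ordered L =
        ⊥-elim (n≮n a (≤-trans (s≤s (head-≥ a (suc n) L))
                        (<-≤-trans (All.lookup B<π C∈π) (minB-≤ C a∈))))

  tail : ∀ {S T B π} → IsLayeredMatching S (B ∷ π) → concat (map toList π) ↭ T →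
         IsLayeredMatching T π
  tail L p with _ ∷ o ← ordered L = record
    { isSetPartition = record { covers = p ; increasing = All.tail (increasing L) ; ordered = o }
    ; intervals = All.tail (intervals L)
    ; sizes     = All.tail (sizes L)
    }

  single∈ : ∀ a n {π} → π ∈ matchings (suc a) n → (single a ∷ π) ∈ matchings a (suc n)
  single∈ a zero    (here refl) = here refl
  single∈ a (suc n) π∈          = ∈-++⁺ˡ (∈-map⁺ (single a ∷_) π∈)

  complete : ∀ a n {π} → IsLayeredMatching (interval a n) π → π ∈ matchings a n
  complete a zero {[]}    L = here refl
  complete a zero {_ ∷ _} L = ⊥-elim (¬x∷xs↭[] (covers L))
  complete a (suc n) {[]} L = ⊥-elim (¬x∷xs↭[] (↭-sym (covers L)))
  complete a (suc n) {(b List⁺.∷ []) ∷ π} L with refl ← minB-first a n L =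
    single∈ a n (complete (suc a) n (tail L (drop-∷ (covers L))))
  complete a (suc n) {(b List⁺.∷ c ∷ []) ∷ π} L = two n b≡a c≡1+a L
    where
    m = minB (b List⁺.∷ c ∷ [])
    m≡a = minB-first a n L

    bc≡ : b ∷ c ∷ [] ≡ m ∷ suc m ∷ []
    bc≡ = All.head (intervals L)

    b≡a = trans (∷-injectiveˡ bc≡) m≡a
    c≡1+a = trans (∷-injectiveˡ (∷-injectiveʳ bc≡)) (cong suc m≡a)

    two : ∀ {b c} n → b ≡ a → c ≡ suc a →
          IsLayeredMatching (interval a (suc n)) ((b List⁺.∷ c ∷ []) ∷ π) →
          ((b List⁺.∷ c ∷ []) ∷ π) ∈ matchings a (suc n)
    two zero    refl refl L = ⊥-elim (¬x∷xs↭[] (drop-∷ (covers L)))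
    two (suc n) refl refl L = ∈-++⁺ʳ (map (single a ∷_) (matchings (suc a) (suc n)))
      (∈-map⁺ (pair a ∷_) (complete (suc (suc a)) n (tail L (drop-∷ (drop-∷ (covers L))))))
  complete a (suc n) {(b List⁺.∷ c ∷ e ∷ bs) ∷ π} L with sizes L
  ... | inj₁ () ∷ _
  ... | inj₂ () ∷ _

∈-matchings⇔ : ∀ a n {π} → π ∈ matchings a n ⇔ IsLayeredMatching (interval a n) π
∈-matchings⇔ a n = mk⇔ (sound a n) (complete a n)

matchings-unique : ∀ a n → Unique (matchings a n)
matchings-unique a zero          = [] ∷ []
matchings-unique a (suc zero)    = [] ∷ []
matchings-unique a (suc (suc n)) = Unique.++⁺
  (Unique.map⁺ ∷-injectiveʳ (matchings-unique (suc a) (suc n)))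
  (Unique.map⁺ ∷-injectiveʳ (matchings-unique (suc (suc a)) n))
  disjoint
  where
  disjoint : ∀ {π} → π ∈ map (single a ∷_) (matchings (suc a) (suc n)) ×
                     π ∈ map (pair a ∷_) (matchings (suc (suc a)) n) → ⊥
  disjoint (p , q) with _ , _ , refl ← ∈-map⁻ (single a ∷_) p | _ , _ , () ← ∈-map⁻ (pair a ∷_) q

{-# OPTIONS --safe #-}

-- Every block of a layered matching contributes (its minimum) − 1 to rb, so Fₙ
-- is a continuant: it counts tilings of a row of n cells in which a monomino and
-- a domino starting at cell p + 1 weigh x qᵖ and y qᵖ.  Cutting the row after
-- cell m splits F_{m+n+1}, F_{m+1} and, after one cell, F_{n+1}(x qᵐ, y qᵐ, q);
-- both sides of the identity then agree as polynomials in the pieces.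
module Submission where

open import Defs
open import Algebra.Bundles using (CommutativeRing)
import Algebra.Properties.CommutativeSemiring.Exp as CommExp
import Algebra.Properties.Semiring.Exp as Exp
import Algebra.Solver.Ring.NaturalCoefficients.Default as RingSolver
open import Data.List.Base using (List; []; _∷_; _++_; foldr; length; map)
open import Data.List.Extrema.Nat using (⊥≤max)
open import Data.List.Properties using (filter-all)
open import Data.List.Relation.Unary.All as All using (All; []; _∷_)
import Data.List.Relation.Unary.All.Properties as All
open import Data.Nat.Base as ℕ using (ℕ; zero; suc)
import Data.Nat.Properties as ℕ
open import Data.Product.Base using (_×_; _,_)
open import Relation.Binary.PropositionalEquality.Core as ≡ using (_≡_; cong; cong₂)
import Relation.Binary.Reasoning.Setoid as SetoidReasoning

-- The effect of a first block on `rb`.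

MaxAtLeast : ℕ → Partition → Set
MaxAtLeast a = All (λ B → a ℕ.≤ maxB B)

matchings-maxAtLeast : ∀ a n → All (MaxAtLeast a) (matchings a n)
matchings-maxAtLeast a zero          = [] ∷ []
matchings-maxAtLeast a (suc zero)    = (ℕ.≤-refl ∷ []) ∷ []
matchings-maxAtLeast a (suc (suc n)) = All.++⁺
  (All.map⁺ (All.map (λ p → ℕ.≤-refl ∷ All.map (ℕ.≤-trans (ℕ.n≤1+n a)) p)
    (matchings-maxAtLeast (suc a) (suc n))))
  (All.map⁺ (All.map (λ p → ⊥≤max a (suc a ∷ []) ∷ All.map (ℕ.≤-trans (ℕ.m≤n+m a 2)) p)
    (matchings-maxAtLeast (suc (suc a)) n)))

-- Lets a factor `q ^ k` per block be shared out among the factors `x` and `y`, of which each block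
-- contributes exactly one.
matchings-length : ∀ a n → All (λ π → length π ≡ s π ℕ.+ d π) (matchings a n)
matchings-length a zero          = ≡.refl ∷ []
matchings-length a (suc zero)    = ≡.refl ∷ []
matchings-length a (suc (suc n)) = All.++⁺
  (All.map⁺ (All.map (cong suc) (matchings-length (suc a) (suc n))))
  (All.map⁺ (All.map (λ {π} p → ≡.trans (cong suc p) (≡.sym (ℕ.+-suc (s π) (d π))))
    (matchings-length (suc (suc a)) n)))

-- Every later block has a maximum above `a`, so the filter discards nothing. The form
-- `k * length π + rb π`, here and in `rb-pair`, is the one `weight-rescale` takes.
rb-single : ∀ a {π} → MaxAtLeast (suc a) π → rb (single a ∷ π) ≡ 1 ℕ.* length π ℕ.+ rb π
rb-single a {π} p =
  cong (λ k → k ℕ.+ 0 ℕ.+ rb π) (cong length (filter-all (λ C → a ℕ.<? maxB C) p))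

rb-pair : ∀ a {π} → MaxAtLeast (suc (suc a)) π → rb (pair a ∷ π) ≡ 2 ℕ.* length π ℕ.+ rb π
rb-pair a {π} p = cong₂ (λ k l → k ℕ.+ (l ℕ.+ 0) ℕ.+ rb π)
  (cong length (filter-all (λ C → a ℕ.<? maxB C) (All.map (ℕ.≤-trans (ℕ.n≤1+n (suc a))) p)))
  (cong length (filter-all (λ C → suc a ℕ.<? maxB C) p))

module _ {c ℓ} (R : CommutativeRing c ℓ) where
  open CommutativeRing R
  open Exp semiring
  open CommExp commutativeSemiring using (^-distrib-*)
  open RingSolver commutativeSemiring
  open SetoidReasoning setoid

  -- Finite sums over lists.

  sumOver : ∀ {a} {A : Set a} → (A → Carrier) → List A → Carrier
  sumOver f xs = foldr _+_ 0# (map f xs)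

  sumOver-++ : ∀ {a} {A : Set a} (f : A → Carrier) xs ys →
               sumOver f (xs ++ ys) ≈ sumOver f xs + sumOver f ys
  sumOver-++ f []       ys = sym (+-identityˡ _)
  sumOver-++ f (x ∷ xs) ys = trans (+-congˡ (sumOver-++ f xs ys)) (sym (+-assoc _ _ _))

  -- The factorisation is asked only of the entries of `xs`, because the weight equations below are
  -- proved only under conditions that the listed matchings satisfy.
  sumOver-map-*ˡ : ∀ {a b} {A : Set a} {B : Set b} (f : B → Carrier) (g : A → Carrier)
                   (h : A → B) k {xs} → All (λ x → f (h x) ≈ k * g x) xs →
                   sumOver f (map h xs) ≈ k * sumOver g xs
  sumOver-map-*ˡ f g h k []       = sym (zeroʳ k)
  sumOver-map-*ˡ f g h k (p ∷ ps) =
    trans (+-cong p (sumOver-map-*ˡ f g h k ps)) (sym (distribˡ k _ _))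

  module _ (q : Carrier) where

    -- From weights of matchings to continuants.

    weight : Carrier → Carrier → Partition → Carrier
    weight x y π = x ^ s π * y ^ d π * q ^ rb π

    rescale : ∀ x y k s d r →
              (x * q ^ k) ^ s * (y * q ^ k) ^ d * q ^ r ≈
              x ^ s * y ^ d * q ^ (k ℕ.* (s ℕ.+ d) ℕ.+ r)
    rescale x y k s d r = begin
      (x * q ^ k) ^ s * (y * q ^ k) ^ d * q ^ r
        ≈⟨ *-congʳ (*-cong (^-distrib-* x (q ^ k) s) (^-distrib-* y (q ^ k) d)) ⟩
      x ^ s * (q ^ k) ^ s * (y ^ d * (q ^ k) ^ d) * q ^ r
        ≈⟨ solve 5 (λ X A Y B C → X :* A :* (Y :* B) :* C := X :* Y :* (A :* B :* C)) refl
             (x ^ s) ((q ^ k) ^ s) (y ^ d) ((q ^ k) ^ d) (q ^ r) ⟩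
      x ^ s * y ^ d * ((q ^ k) ^ s * (q ^ k) ^ d * q ^ r)
        ≈⟨ *-congˡ (*-congʳ (^-homo-* (q ^ k) s d)) ⟨
      x ^ s * y ^ d * ((q ^ k) ^ (s ℕ.+ d) * q ^ r)
        ≈⟨ *-congˡ (*-congʳ (^-assocʳ q k (s ℕ.+ d))) ⟩
      x ^ s * y ^ d * (q ^ (k ℕ.* (s ℕ.+ d)) * q ^ r)
        ≈⟨ *-congˡ (^-homo-* q (k ℕ.* (s ℕ.+ d)) r) ⟨
      x ^ s * y ^ d * q ^ (k ℕ.* (s ℕ.+ d) ℕ.+ r) ∎

    weight-rescale : ∀ x y k π {r} → length π ≡ s π ℕ.+ d π → r ≡ k ℕ.* length π ℕ.+ rb π →
                     x ^ s π * y ^ d π * q ^ r ≈ weight (x * q ^ k) (y * q ^ k) π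
    weight-rescale x y k π len ≡.refl rewrite len = sym (rescale x y k (s π) (d π) (rb π))

    weight-single : ∀ x y a {π} → MaxAtLeast (suc a) π × length π ≡ s π ℕ.+ d π →
                    weight x y (single a ∷ π) ≈ x * weight (x * q ^ 1) (y * q ^ 1) π
    weight-single x y a {π} (p , len) = trans
      (solve 4 (λ x X Y Q → x :* X :* Y :* Q := x :* (X :* Y :* Q)) refl
        x (x ^ s π) (y ^ d π) (q ^ rb (single a ∷ π)))
      (*-congˡ (weight-rescale x y 1 π len (rb-single a p)))

    weight-pair : ∀ x y a {π} → MaxAtLeast (suc (suc a)) π × length π ≡ s π ℕ.+ d π →
                  weight x y (pair a ∷ π) ≈ y * weight (x * q ^ 2) (y * q ^ 2) π
    weight-pair x y a {π} (p , len) = trans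
      (solve 4 (λ y X Y Q → X :* (y :* Y) :* Q := y :* (X :* Y :* Q)) refl
        y (x ^ s π) (y ^ d π) (q ^ rb (pair a ∷ π)))
      (*-congˡ (weight-rescale x y 2 π len (rb-pair a p)))

    -- Recursion on the first tile: the cells after it move by 1 or 2 places, which multiplies both
    -- tile weights by `q ^ 1` or `q ^ 2`.
    continuant : ℕ → Carrier → Carrier → Carrier
    continuant zero          x y = 1#
    continuant (suc zero)    x y = x
    continuant (suc (suc n)) x y =
      x * continuant (suc n) (x * q ^ 1) (y * q ^ 1) + y * continuant n (x * q ^ 2) (y * q ^ 2)

    -- The starting point `a` is general because the induction advances it; the value is independent
    -- of `a`, as `rb` depends only on the relative order of the elements.
    sumOver-matchings : ∀ a n x y → sumOver (weight x y) (matchings a n) ≈ continuant n x y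
    sumOver-matchings a zero x y =
      solve 0 (con 1 :* con 1 :* con 1 :+ con 0 := con 1) refl
    sumOver-matchings a (suc zero) x y =
      solve 1 (λ x → x :* con 1 :* con 1 :* con 1 :+ con 0 := x) refl x
    sumOver-matchings a (suc (suc n)) x y = begin
      sumOver (weight x y) (map (single a ∷_) πs ++ map (pair a ∷_) ρs)
        ≈⟨ sumOver-++ (weight x y) (map (single a ∷_) πs) (map (pair a ∷_) ρs) ⟩
      sumOver (weight x y) (map (single a ∷_) πs) + sumOver (weight x y) (map (pair a ∷_) ρs)
        ≈⟨ +-cong
             (sumOver-map-*ˡ _ _ (single a ∷_) x (All.map (λ {π} → weight-single x y a {π})
               (All.zip (matchings-maxAtLeast (suc a) (suc n) , matchings-length (suc a) (suc n)))))
             (sumOver-map-*ˡ _ _ (pair a ∷_) y (All.map (λ {π} → weight-pair x y a {π})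
               (All.zip (matchings-maxAtLeast (suc (suc a)) n , matchings-length (suc (suc a)) n)))) ⟩
      x * sumOver (weight (x * q ^ 1) (y * q ^ 1)) πs + y * sumOver (weight (x * q ^ 2) (y * q ^ 2)) ρs
        ≈⟨ +-cong (*-congˡ (sumOver-matchings (suc a) (suc n) _ _))
                  (*-congˡ (sumOver-matchings (suc (suc a)) n _ _)) ⟩
      continuant (suc (suc n)) x y ∎
      where
      πs = matchings (suc a) (suc n)
      ρs = matchings (suc (suc a)) n

    F≈continuant : ∀ n x y → F R n x y q ≈ continuant n x y
    F≈continuant = sumOver-matchings 1

    -- Shifted rows and cutting a row.

    continuant-cong : ∀ n {x x′ y y′} → x ≈ x′ → y ≈ y′ → continuant n x y ≈ continuant n x′ y′
    continuant-cong zero          p r = refl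
    continuant-cong (suc zero)    p r = p
    continuant-cong (suc (suc n)) p r = +-cong
      (*-cong p (continuant-cong (suc n) (*-congʳ p) (*-congʳ r)))
      (*-cong r (continuant-cong n (*-congʳ p) (*-congʳ r)))

    -- The tilings of cells `p + 1` to `p + n` of a longer row, with the weights they have there.
    shifted : ℕ → ℕ → Carrier → Carrier → Carrier
    shifted p n x y = continuant n (x * q ^ p) (y * q ^ p)

    *-shift : ∀ z j k → z * q ^ j * q ^ k ≈ z * q ^ (j ℕ.+ k)
    *-shift z j k = trans (*-assoc z _ _) (*-congˡ (sym (^-homo-* q j k)))

    shifted-shifted : ∀ j k n x y →
                      shifted k n (x * q ^ j) (y * q ^ j) ≈ shifted (j ℕ.+ k) n x y
    shifted-shifted j k n x y = continuant-cong n (*-shift x j k) (*-shift y j k)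

    -- Cut after cell `m + 1`. Either no tile crosses the cut, or a domino of weight `y * q ^ m`
    -- does and leaves `m` cells before it and `n` after it. The induction removes the first tile.
    continuant-split : ∀ m n x y →
      continuant (suc m ℕ.+ suc n) x y ≈
      continuant (suc m) x y * shifted (suc m) (suc n) x y +
      y * q ^ m * (continuant m x y * shifted (2 ℕ.+ m) n x y)
    continuant-split zero n x y = +-congˡ
      (solve 2 (λ y K → y :* K := y :* con 1 :* (con 1 :* K)) refl y (shifted 2 n x y))
    -- A separate base case: a first domino would fill the whole left part, leaving nothing there to
    -- cut.
    continuant-split (suc zero) n x y = begin
      x * continuant (suc (suc n)) (x * q ^ 1) (y * q ^ 1) + y * shifted 2 (suc n) x y
        ≈⟨ +-congʳ (*-congˡ (+-cong (*-congˡ (shifted-shifted 1 1 (suc n) x y))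
                                     (*-congˡ (shifted-shifted 1 2 n x y)))) ⟩
      x * (x * q ^ 1 * K + y * q ^ 1 * L) + y * K
        ≈⟨ solve 6 (λ x y xq yq K L → x :* (xq :* K :+ yq :* L) :+ y :* K :=
                      (x :* xq :+ y :* con 1) :* K :+ yq :* (x :* L)) refl
             x y (x * q ^ 1) (y * q ^ 1) K L ⟩
      (x * (x * q ^ 1) + y * 1#) * K + y * q ^ 1 * (x * L) ∎
      where
      K = shifted 2 (suc n) x y
      L = shifted 3 n x y
    continuant-split (suc (suc m)) n x y = begin
      x * continuant (suc (suc m) ℕ.+ suc n) (x * q ^ 1) (y * q ^ 1) +
      y * continuant (suc m ℕ.+ suc n) (x * q ^ 2) (y * q ^ 2)
        ≈⟨ +-cong (*-congˡ (continuant-split (suc m) n (x * q ^ 1) (y * q ^ 1)))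
                  (*-congˡ (continuant-split m n (x * q ^ 2) (y * q ^ 2))) ⟩
      x * (A * shifted (2 ℕ.+ m) (suc n) (x * q ^ 1) (y * q ^ 1) +
           y * q ^ 1 * q ^ suc m * (C * shifted (3 ℕ.+ m) n (x * q ^ 1) (y * q ^ 1))) +
      y * (B * shifted (suc m) (suc n) (x * q ^ 2) (y * q ^ 2) +
           y * q ^ 2 * q ^ m * (D * shifted (2 ℕ.+ m) n (x * q ^ 2) (y * q ^ 2)))
        -- Once the shifts are composed, both branches have the same right pieces `K`, `L` and the
        -- same crossing domino `Y`, since these depend only on absolute position.
        ≈⟨ +-cong
             (*-congˡ (+-cong (*-congˡ (shifted-shifted 1 (2 ℕ.+ m) (suc n) x y))
               (*-cong (*-shift y 1 (suc m)) (*-congˡ (shifted-shifted 1 (3 ℕ.+ m) n x y)))))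
             (*-congˡ (+-cong (*-congˡ (shifted-shifted 2 (suc m) (suc n) x y))
               (*-cong (*-shift y 2 m) (*-congˡ (shifted-shifted 2 (2 ℕ.+ m) n x y))))) ⟩
      x * (A * K + Y * (C * L)) + y * (B * K + Y * (D * L))
        ≈⟨ solve 9 (λ x y Y A B C D K L →
                      x :* (A :* K :+ Y :* (C :* L)) :+ y :* (B :* K :+ Y :* (D :* L)) :=
                      (x :* A :+ y :* B) :* K :+ Y :* ((x :* C :+ y :* D) :* L)) refl
             x y Y A B C D K L ⟩
      (x * A + y * B) * K + Y * ((x * C + y * D) * L) ∎
      where
      A = shifted 1 (suc (suc m)) x y
      B = shifted 2 (suc m) x y
      C = shifted 1 (suc m) x y
      D = shifted 2 m x y
      K = shifted (3 ℕ.+ m) (suc n) x y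
      L = shifted (4 ℕ.+ m) n x y
      Y = y * q ^ (2 ℕ.+ m)

    -- The two rows on the left share cell `m + 2`. If one of them has a monomino there, of weight
    -- `X`, taking it out leaves a tiling of the long row. Otherwise dominoes of weights `Y` and `Z`
    -- overlap in that cell, which is the last term.
    continuant-identity : ∀ m n x y →
      continuant (2 ℕ.+ m) x y * shifted (suc m) (2 ℕ.+ n) x y ≈
      x * q ^ suc m * continuant (2 ℕ.+ m ℕ.+ suc n) x y +
      y * q ^ m * (y * q ^ suc m) * continuant m x y * shifted (3 ℕ.+ m) n x y
    continuant-identity m n x y = begin
      continuant (2 ℕ.+ m) x y * shifted (suc m) (2 ℕ.+ n) x y
        ≈⟨ *-congˡ expandʳ ⟩
      continuant (2 ℕ.+ m) x y * (X * K + Z * L)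
        ≈⟨ distribˡ _ _ _ ⟩
      continuant (2 ℕ.+ m) x y * (X * K) + continuant (2 ℕ.+ m) x y * (Z * L)
        -- Only the summand with `Z` is expanded further; in the other one the second row already
        -- has its monomino `X` on the shared cell.
        ≈⟨ +-congˡ (*-congʳ expandˡ) ⟩
      continuant (2 ℕ.+ m) x y * (X * K) + (A * X + Y * B) * (Z * L)
        ≈⟨ solve 8 (λ P A B X Y Z K L →
                      P :* (X :* K) :+ (A :* X :+ Y :* B) :* (Z :* L) :=
                      X :* (P :* K :+ Z :* (A :* L)) :+ Y :* Z :* B :* L) refl
             (continuant (2 ℕ.+ m) x y) A B X Y Z K L ⟩
      X * (continuant (2 ℕ.+ m) x y * K + Z * (A * L)) + Y * Z * B * L
        ≈⟨ +-congʳ (*-congˡ (continuant-split (suc m) n x y)) ⟨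
      X * continuant (2 ℕ.+ m ℕ.+ suc n) x y + Y * Z * B * L ∎
      where
      A = continuant (suc m) x y
      B = continuant m x y
      K = shifted (2 ℕ.+ m) (suc n) x y
      L = shifted (3 ℕ.+ m) n x y
      X = x * q ^ suc m
      Y = y * q ^ m
      Z = y * q ^ suc m

      expandˡ : continuant (2 ℕ.+ m) x y ≈ A * X + Y * B
      expandˡ = begin
        -- Expansion by the last tile is a cut with a single cell on the right.
        continuant (2 ℕ.+ m) x y            ≡⟨ cong (λ k → continuant (suc k) x y) (ℕ.+-comm 1 m) ⟩
        continuant (suc m ℕ.+ 1) x y        ≈⟨ continuant-split m 0 x y ⟩
        A * X + Y * (B * 1#)                ≈⟨ +-congˡ (*-congˡ (*-identityʳ B)) ⟩
        A * X + Y * B                       ∎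

      expandʳ : shifted (suc m) (2 ℕ.+ n) x y ≈ X * K + Z * L
      expandʳ = +-cong
        (*-congˡ (trans (shifted-shifted (suc m) 1 (suc n) x y)
          (reflexive (cong (λ k → shifted (suc k) (suc n) x y) (ℕ.+-comm m 1)))))
        (*-congˡ (trans (shifted-shifted (suc m) 2 n x y)
          (reflexive (cong (λ k → shifted (suc k) n x y) (ℕ.+-comm m 2)))))

    dominoes-weight : ∀ y m → y * q ^ m * (y * q ^ suc m) ≈ y ^ 2 * q ^ (2 ℕ.* suc m ℕ.∸ 1)
    dominoes-weight y m = begin
      y * q ^ m * (y * q ^ suc m)
        ≈⟨ solve 3 (λ y A B → y :* A :* (y :* B) := y :* (y :* con 1) :* (A :* B)) refl
             y (q ^ m) (q ^ suc m) ⟩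
      y ^ 2 * (q ^ m * q ^ suc m)
        ≈⟨ *-congˡ (^-homo-* q m (suc m)) ⟨
      y ^ 2 * q ^ (m ℕ.+ suc m)
        -- The exponent `2 * suc m ∸ 1` computes to `m + suc (m + 0)`, so only the `+ 0` is left to
        -- remove.
        ≡⟨ cong (λ k → y ^ 2 * q ^ (m ℕ.+ suc k)) (ℕ.+-identityʳ m) ⟨
      y ^ 2 * q ^ (m ℕ.+ suc (m ℕ.+ 0)) ∎

theorem4p4 : ∀ {c ℓ} (R : CommutativeRing c ℓ) →
  let open CommutativeRing R
      open Exp semiring using (_^_)
  in
  ∀ (x y q : Carrier) (m n : ℕ) → 1 ℕ.≤ m → 1 ℕ.≤ n →
  F R (m ℕ.+ 1) x y q * F R (n ℕ.+ 1) (x * q ^ m) (y * q ^ m) q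
    ≈ x * q ^ m * F R (m ℕ.+ n ℕ.+ 1) x y q
      + y ^ 2 * q ^ (2 ℕ.* m ℕ.∸ 1) * F R (m ℕ.∸ 1) x y q
          * F R (n ℕ.∸ 1) (x * q ^ (m ℕ.+ 2)) (y * q ^ (m ℕ.+ 2)) q
-- With both indices successors, `m ∸ 1` and `n ∸ 1` become true predecessors. The rewrites move the
-- numerals to the front so that the indices match those of `continuant-identity`.
theorem4p4 R x y q (suc m) (suc n) _ _
  rewrite ℕ.+-comm m 1 | ℕ.+-comm n 1 | ℕ.+-comm (m ℕ.+ suc n) 1 | ℕ.+-comm m 2 = begin
  F R (2 ℕ.+ m) x y q * F R (2 ℕ.+ n) (x * q ^ suc m) (y * q ^ suc m) q
    ≈⟨ *-cong (F≈continuant R q (2 ℕ.+ m) x y) (F≈continuant R q (2 ℕ.+ n) _ _) ⟩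
  continuant R q (2 ℕ.+ m) x y * shifted R q (suc m) (2 ℕ.+ n) x y
    ≈⟨ continuant-identity R q m n x y ⟩
  x * q ^ suc m * continuant R q (2 ℕ.+ m ℕ.+ suc n) x y +
  y * q ^ m * (y * q ^ suc m) * continuant R q m x y * shifted R q (3 ℕ.+ m) n x y
    ≈⟨ +-cong (*-congˡ (sym (F≈continuant R q (2 ℕ.+ m ℕ.+ suc n) x y)))
         (*-cong (*-cong (dominoes-weight R q y m) (sym (F≈continuant R q m x y)))
                 (sym (F≈continuant R q n _ _))) ⟩
  x * q ^ suc m * F R (2 ℕ.+ m ℕ.+ suc n) x y q +
  y ^ 2 * q ^ (2 ℕ.* suc m ℕ.∸ 1) * F R m x y q *
    F R n (x * q ^ (3 ℕ.+ m)) (y * q ^ (3 ℕ.+ m)) q ∎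
  where
  open CommutativeRing R
  open Exp semiring using (_^_)
  open SetoidReasoning setoid
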